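{- For every integer $n>1$, the number of maximal Gallai partitions of the set of edges of the complete graph $K_n$ is equal to the double factorial $(2n-3)!!=1\cdot 3\cdot 5\cdots(2n-3)$.
   Context: $K_n$ is the complete graph on the labeled vertex set $\{1,\dots,n\}$. A Gallai $k$-partition of $K_n$ is a (unordered) partition of its edge set into $k$ nonempty blocks such that every cycle of $K_n$ contains at least two edges belonging to the same block (i.e. there is no rainbow cycle). The maximal possible number of blocks in a Gallai partition of $K_n$ is $n-1$; a Gallai partition is maximal if it has exactly $n-1$ blocks. -}

module Defs where

open import Level using (0ℓ)
open import Data.Nat using (ℕ; zero; suc; _+_; _*_; _∸_)
open import Data.Nat.DivMod using (_mod_)
open import Data.Fin using (Fin; toℕ; _<_)
open import Data.Product using (∃-syntax; _×_; _,_; proj₁)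
open import Data.Sum using (_⊎_)
open import Function.Bundles using (Bijection)
open import Function.Definitions using (Injective)
open import Relation.Binary using (Setoid; IsEquivalence)
import Relation.Binary.Construct.On as On
open import Relation.Binary.PropositionalEquality using (_≡_; _≢_; setoid)
open import Relation.Unary using (Pred; _∈_; _⊥_; _≐_; Satisfiable)
open import Relation.Unary.Properties using (≐-refl; ≐-trans)

infix 8 _!!
_!! : ℕ → ℕ
zero !!        = 1
suc zero !!    = 1
suc (suc n) !! = suc (suc n) * n !!

-- An unordered pair of distinct vertices is stored in increasing order.  The
-- proof field is irrelevant, so an edge is determined by its two endpoints.
record Edge (n : ℕ) : Set where
  constructor edge
  field
    lo hi  : Fin n
    .lo<hi : lo < hi

_Joins_and_ : ∀ {n} → Edge n → Fin n → Fin n → Set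
e Joins u and v = (u ≡ Edge.lo e × v ≡ Edge.hi e) ⊎ (u ≡ Edge.hi e × v ≡ Edge.lo e)

-- Cycles have length at least 3 and no repeated vertex; `edgeAt i` connects
-- the i-th vertex to the next one, cyclically.
record Cycle (n : ℕ) : Set where
  field
    length-3 : ℕ

  length : ℕ
  length = 3 + length-3

  next : Fin length → Fin length
  next i = suc (toℕ i) mod length

  field
    vertexAt : Fin length → Fin n
    edgeAt   : Fin length → Edge n
    distinct : Injective _≡_ _≡_ vertexAt
    joins    : ∀ i → edgeAt i Joins vertexAt i and vertexAt (next i)

  Contains : Edge n → Set
  Contains e = ∃[ i ] edgeAt i ≡ e

-- The indexing of the blocks by Fin k only serves to say that there are k of
-- them; `_≈ᴾ_` below forgets it.
record Partition (A : Set) (k : ℕ) : Set₁ where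
  field
    block    : Fin k → Pred A 0ℓ
    nonempty : ∀ i → Satisfiable (block i)
    disjoint : ∀ {i j} → i ≢ j → block i ⊥ block j
    cover    : ∀ a → ∃[ i ] a ∈ block i

module _ {A : Set} {k : ℕ} where

  open Partition

  -- P and Q are equal as sets of blocks, blocks being compared extensionally.
  _≈ᴾ_ : Partition A k → Partition A k → Set
  P ≈ᴾ Q = (∀ i → ∃[ j ] block P i ≐ block Q j)
         × (∀ j → ∃[ i ] block Q j ≐ block P i)

  ≈ᴾ-isEquivalence : IsEquivalence _≈ᴾ_
  ≈ᴾ-isEquivalence = record
    { refl  = (λ i → i , ≐-refl) , (λ i → i , ≐-refl)
    ; sym   = λ (f , g) → g , f
    ; trans = λ (f , g) (f′ , g′) →
        (λ i → let (j , p) = f i ; (l , q) = f′ j in l , ≐-trans p q) ,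
        (λ l → let (j , q) = g′ l ; (i , p) = g j in i , ≐-trans q p)
    }

partitionSetoid : Set → ℕ → Setoid _ _
partitionSetoid A k = record { isEquivalence = ≈ᴾ-isEquivalence {A} {k} }

IsGallai : ∀ {n k} → Partition (Edge n) k → Set
IsGallai {n} P = (C : Cycle n) → let open Cycle C in
  ∃[ e ] ∃[ f ] e ≢ f × Contains e × Contains f × (∃[ b ] e ∈ block b × f ∈ block b)
  where open Partition P

GallaiPartition : ℕ → ℕ → Set₁
GallaiPartition n k = ∃[ P ] IsGallai {n} {k} P

gallaiSetoid : ℕ → ℕ → Setoid _ _
gallaiSetoid n k =
  On.setoid {B = GallaiPartition n k} (partitionSetoid (Edge n) k) proj₁

maximalGallaiSetoid : ℕ → Setoid _ _
maximalGallaiSetoid n = gallaiSetoid n (n ∸ 1)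

HasCardinality : ∀ {a ℓ} → Setoid a ℓ → ℕ → Set _
HasCardinality S N = Bijection (setoid (Fin N)) S

{-# OPTIONS --safe #-}
module Submission where

open import Defs
open import Data.Nat using (ℕ; zero; suc; _+_; _*_; _∸_; _%_; _>_; s≤s)
open import Data.Nat.DivMod using (m<n⇒m%n≡m; n%n≡0; m%n<n)
import Data.Nat.Properties as ℕ
open import Data.Bool using (if_then_else_)
open import Data.Empty using (⊥-elim)
open import Data.Fin using (Fin; zero; suc; punchIn; toℕ; fromℕ; inject₁; splitAt; join; _<_)
open import Data.Fin.Induction using (<-weakInduction)
import Data.Fin.Properties as Fin
open import Data.Fin.Relation.Unary.Top using (view; ‵fromℕ; ‵inject₁)
open import Data.List using (List; []; _∷_; allFin)
open import Data.List.Membership.Propositional using () renaming (_∈_ to _∈ˡ_)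
open import Data.List.Membership.Propositional.Properties using (∈-allFin)
open import Data.List.Relation.Unary.Any using (here; there)
import Data.Product as Product
open import Data.Product using (Σ-syntax; ∃-syntax; _×_; _,_; proj₁; proj₂)
open import Data.Product.Function.NonDependent.Propositional using (_×-↔_)
open import Data.Sum using (_⊎_; inj₁; inj₂; map₂; [_,_]′; swap)
import Data.Sum.Properties as Sum
open import Data.Sum.Properties using (inj₁-injective; inj₂-injective)
open import Data.Unit using (⊤; tt)
open import Function using (_∘_; case_of_; _↔_; mk↔ₛ′; Inverse; Injection)
open import Function.Definitions using (Injective)
open import Function.Properties.Inverse using (↔-trans; ↔⇒↣)
open import Level using (0ℓ)
open import Relation.Binary using (DecidableEquality; tri<; tri≈; tri>; IsEquivalence)
open import Relation.Binary.PropositionalEquality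
  using (_≡_; _≢_; refl; sym; trans; cong; subst; subst₂; module ≡-Reasoning)
open import Relation.Nullary using (¬_; yes; no; contradiction; contradiction-irr)
open import Relation.Nullary.Decidable using (does; ¬?)
open import Relation.Unary using (Pred; _∈_; _∉_; _⊆_; _≐_; Decidable)

-- A maximal Gallai partition colours every edge uv of K_n by the lowest common
-- ancestor of u and v in a binary tree with leaves 1, …, n, and conversely.
-- Indeed, two colours occurring only at a vertex v, on va and vb, would make
-- the triangle vab rainbow; so deleting v loses at most one colour, a maximal
-- partition loses exactly one, say p, and the rest is again maximal.  The
-- p-neighbours of v form a homogeneous set S: a vertex w outside S sees all of
-- S in the same colour, and this is also the colour of vw.  So the partition is
-- determined by S and the smaller one.  In the colouring given by a tree the
-- nonempty homogeneous sets are exactly the sets of leaves below its nodes, and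
-- each of them gives an extension.  As a tree with n − 1 leaves has 2n − 3
-- nodes, the number of partitions is multiplied by 2n − 3.

-- Gallai colourings and homogeneous sets.

TwoEqual : {K : Set} → K → K → K → Set
TwoEqual a b c = a ≡ b ⊎ b ≡ c ⊎ a ≡ c

module _ {V K : Set} where

  -- Loops are coloured as well, each with a colour of its own: then every
  -- node of a tree, leaf or not, is a colour, and degenerate triangles need no
  -- separate treatment.
  record IsGallaiColouring (γ : V → V → K) : Set where
    field
      symmetric : ∀ u v → γ u v ≡ γ v u
      triangle  : ∀ u v w → TwoEqual (γ u v) (γ v w) (γ u w)
      loop      : ∀ {u v w} → γ u u ≡ γ v w → u ≡ v

    loopʳ : ∀ {u v w} → γ u u ≡ γ v w → u ≡ w
    loopʳ {_} {v} {w} eq = loop (trans eq (symmetric v w))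

  Homogeneous : (V → V → K) → Pred V 0ℓ → Set
  Homogeneous γ Q = ∀ {s t w} → s ∈ Q → t ∈ Q → w ∉ Q → γ s w ≡ γ t w

  -- When γ u v is the lowest common ancestor of u and v in a tree, these are
  -- the leaves below the node x.
  Below : (V → V → K) → K → Pred V 0ℓ
  Below γ x w = ∃[ u ] γ w u ≡ x

-- Binary trees as colourings.

Node : ℕ → Set
Node m = Fin (suc m) ⊎ Fin m

_≟_ : ∀ {m} → DecidableEquality (Node m)
_≟_ = Sum.≡-dec Fin._≟_ Fin._≟_

-- The colourings of the pairs of leaves of a binary tree by their lowest
-- common ancestors; inj₁ is for the leaves and inj₂ for the internal nodes.
record IsTree {m} (δ : Fin (suc m) → Fin (suc m) → Node m) : Set where
  field
    symmetric  : ∀ u v → δ u v ≡ δ v u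
    triangle   : ∀ u v w → TwoEqual (δ u v) (δ v w) (δ u w)
    loop       : ∀ u → δ u u ≡ inj₁ u
    leaf       : ∀ {u v w} → δ u v ≡ inj₁ w → u ≡ w
    -- Binary branching: only two subtrees hang from a node, so two of three distinct leaves below
    -- it share a subtree and meet lower down.
    noMono     : ∀ {u v w} → δ u v ≡ δ v w → δ u v ≡ δ u w → u ≡ v
    -- The edges of one internal colour form a complete bipartite graph between the leaves of two
    -- subtrees, so `a` is joined to one end of `uw`.
    connected  : ∀ {a b u w} → δ a b ≡ δ u w → δ a u ≡ δ a b ⊎ δ a w ≡ δ a b
    surjective : ∀ x → ∃[ u ] ∃[ v ] δ u v ≡ x

  isGallaiColouring : IsGallaiColouring δ
  isGallaiColouring = record
    { symmetric = symmetric
    ; triangle  = triangle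
    ; loop      = λ {u} {v} {w} eq → sym (leaf (trans (sym eq) (loop u)))
    }

-- Homogeneous sets of a tree.

module TreeProperties {m} {δ : Fin (suc m) → Fin (suc m) → Node m} (isTree : IsTree δ) where

  open IsTree isTree

  abstract
    below? : ∀ x → Decidable (Below δ x)
    below? x w = Fin.any? (λ u → δ w u ≟ x)

  -- By `connected`, `s` and `t` are linked by a path of edges of colour `x`. Along such an edge
  -- `ab` the colour towards `w` is constant: in the triangle `abw` the edges at `w` do not have
  -- colour `x`, so they agree.
  below-homogeneous : ∀ x → Homogeneous δ (Below δ x)
  below-homogeneous x {s} {t} {w} (u , su) (v , tv) w∉ =
    case connected (trans su (sym tv)) of λ where
      (inj₁ st) → adjacent (trans st su)
      (inj₂ sv) → trans (adjacent (trans sv su)) (sym (adjacent tv))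
    where
    adjacent : ∀ {a b} → δ a b ≡ x → δ a w ≡ δ b w
    adjacent {a} {b} ab with triangle a b w
    ... | inj₁ eq        = contradiction (b , trans (symmetric w b) (trans (sym eq) ab)) w∉
    ... | inj₂ (inj₁ eq) = sym eq
    ... | inj₂ (inj₂ eq) = contradiction (a , trans (symmetric w a) (trans (sym eq) ab)) w∉

  -- If `az` had the colour of `ab`, homogeneity would give `bz` that colour too, and `noMono` would
  -- force `a ≡ z`.
  colour-confined : ∀ {Q a b z} → Homogeneous δ Q → a ∈ Q → b ∈ Q → z ∉ Q → δ a z ≢ δ a b
  colour-confined {Q} {b = b} {z} hom a∈ b∈ z∉ az =
    z∉ (subst Q (noMono (trans (hom a∈ b∈ z∉) (symmetric b z)) az) a∈)

  -- By homogeneity and `colour-confined`, the colour of `ab` occurs on no edge leaving `Q`; an edge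
  -- of that colour with both ends outside would produce one by `connected`.
  below-least : ∀ {Q a b} → Decidable Q → Homogeneous δ Q → a ∈ Q → b ∈ Q →
                Below δ (δ a b) ⊆ Q
  below-least {Q} {a} {b} Q? hom a∈ b∈ {w} (u , wu) with Q? w
  ... | yes w∈ = w∈
  ... | no  w∉ with Q? u
  ...   | yes u∈ = contradiction (trans (hom a∈ u∈ w∉) (trans (symmetric u w) wu))
                                 (colour-confined hom a∈ b∈ w∉)
  ...   | no  u∉ = ⊥-elim ([ colour-confined hom a∈ b∈ w∉ , colour-confined hom a∈ b∈ u∉ ]′
                             (connected (sym wu)))

  -- For `x ≢ y`, an edge `ab` of colour `x` yields `a′` and `b′` with `aa′`, `bb′`, `ab′` and
  -- `a′b′` all of colour `y`. Then `noMono` gives `a ≡ b′`, and `ab` has colour `y` as well.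
  below-injective : ∀ {x y} → Below δ x ≐ Below δ y → x ≡ y
  below-injective {x} {y} (x⊆y , y⊆x) with x ≟ y
  ... | yes x≡y = x≡y
  ... | no  x≢y =
    let (a , b , ab)   = surjective x
        (a′ , aa′)     = x⊆y (b , ab)
        (b′ , bb′)     = x⊆y (a , trans (symmetric b a) ab)
        a′a            = trans (symmetric a′ a) aa′
        (a″ , a′a″)    = y⊆x (a , a′a)
        a′b            = other x≢y (connected (trans a′a″ (sym ab))) a′a″ a′a
        ab′            = other (x≢y ∘ sym) (connected (trans aa′ (sym bb′))) aa′ ab
        a′b′           = other (x≢y ∘ sym) (connected (trans a′a (sym bb′))) a′a a′b
        a≡b′           = noMono (trans ab′ (sym (trans (symmetric b′ a′) a′b′)))
                                (trans ab′ (sym aa′))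
    in trans (sym ab) (trans (symmetric a b) (trans (cong (δ b) a≡b′) bb′))
    where
    other : ∀ {x y c d e f} → x ≢ y → δ c e ≡ δ c d ⊎ δ c f ≡ δ c d →
            δ c d ≡ x → δ c e ≡ y → δ c f ≡ x
    other x≢y (inj₁ eq) cd ce = contradiction (trans (sym cd) (trans (sym eq) ce)) x≢y
    other x≢y (inj₂ eq) cd ce = trans eq cd

  -- If the leaf t of Q is not below δ r s, then δ r t is a higher node, and so
  -- running through all leaves yields a node above the whole of Q.
  homogeneous⇒below : ∀ {Q r} → Decidable Q → Homogeneous δ Q → r ∈ Q →
                      ∃[ x ] Q ≐ Below δ x
  homogeneous⇒below {Q} {r} Q? hom r∈ =
    let (s , s∈ , Q⊆) = above (allFin _)
    in δ r s , Q⊆ (∈-allFin _) , below-least Q? hom r∈ s∈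
    where
    above : (L : List (Fin (suc m))) →
            ∃[ s ] s ∈ Q × (∀ {t} → t ∈ˡ L → t ∈ Q → t ∈ Below δ (δ r s))
    above []      = r , r∈ , λ ()
    above (t ∷ L) with above L | Q? t
    ... | s , s∈ , L⊆ | no t∉ = s , s∈ , λ where
      (here refl) t∈ → contradiction t∈ t∉
      (there u∈)     → L⊆ u∈
    ... | s , s∈ , L⊆ | yes t∈ with below? (δ r s) t
    ...   | yes t≤ = s , s∈ , λ where
      (here refl) _ → t≤
      (there u∈)    → L⊆ u∈
    ...   | no t≰ = t , t∈ , λ where
      (here refl) _ → r , symmetric t r
      -- `t` is outside the homogeneous set below `δ r s`, so `δ s t ≡ δ r t` and `s` is below
      -- `δ r t`, like `r`. Minimality then puts everything below `δ r s` under `δ r t`.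
      (there u∈) u∈Q → below-least (below? (δ r t)) (below-homogeneous (δ r t))
        (t , refl)
        (t , below-homogeneous (δ r s) (r , symmetric s r) (s , refl) t≰)
        (L⊆ u∈ u∈Q)

-- Grafting a new leaf onto a tree.

old : ∀ {m} → Node m → Node (suc m)
old (inj₁ u) = inj₁ (suc u)
old (inj₂ i) = inj₂ (suc i)

old-injective : ∀ {m} {x y : Node m} → old x ≡ old y → x ≡ y
old-injective {x = inj₁ _} {inj₁ _} refl = refl
old-injective {x = inj₂ _} {inj₂ _} refl = refl

old≢leaf : ∀ {m} {x : Node m} → old x ≢ inj₁ zero
old≢leaf {x = inj₁ _} ()
old≢leaf {x = inj₂ _} ()

old≢inner : ∀ {m} {x : Node m} → old x ≢ inj₂ zero
old≢inner {x = inj₁ _} ()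
old≢inner {x = inj₂ _} ()

module Graft {m} {δ : Fin (suc m) → Fin (suc m) → Node m} (isTree : IsTree δ) (x : Node m) where

  open IsTree isTree
  open TreeProperties isTree

  S : Pred (Fin (suc m)) 0ℓ
  S = Below δ x

  r : Fin (suc m)
  r = proj₁ (surjective x)

  r∈S : r ∈ S
  r∈S = proj₂ (surjective x)

  -- The new leaf is `zero`, and `inj₂ zero` is the node subdividing the edge above `x`. The choice
  -- of `r` in `S` is immaterial by homogeneity.
  attach : Fin (suc m) → Node (suc m)
  attach w = if does (below? x w) then inj₂ zero else old (δ r w)

  graft : Fin (suc (suc m)) → Fin (suc (suc m)) → Node (suc m)
  graft zero    zero    = inj₁ zero
  graft zero    (suc w) = attach w
  graft (suc w) zero    = attach w
  graft (suc u) (suc v) = old (δ u v)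

  attach-∈ : ∀ {w} → w ∈ S → attach w ≡ inj₂ zero
  attach-∈ {w} w∈ with below? x w
  ... | yes _  = refl
  ... | no  w∉ = contradiction w∈ w∉

  attach-∉ : ∀ {s w} → s ∈ S → w ∉ S → attach w ≡ old (δ s w)
  attach-∉ {s} {w} s∈ w∉ with below? x w
  ... | yes w∈ = contradiction w∈ w∉
  ... | no  _  = cong old (below-homogeneous x r∈S s∈ w∉)

  collapse : Fin (suc (suc m)) → Fin (suc m)
  collapse zero    = r
  collapse (suc w) = w

  -- Away from the close pairs, the new leaf is indistinguishable from r.
  Close : Fin (suc (suc m)) → Fin (suc (suc m)) → Set
  Close a b = (a ≡ zero ⊎ b ≡ zero) × collapse a ∈ S × collapse b ∈ S

  data Case (a b : Fin (suc (suc m))) : Node (suc m) → Set where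
    corner : a ≡ zero → b ≡ zero → Case a b (inj₁ zero)
    innerʳ : ∀ {s} → a ≡ zero → b ≡ suc s → s ∈ S → Case a b (inj₂ zero)
    innerˡ : ∀ {s} → a ≡ suc s → b ≡ zero → s ∈ S → Case a b (inj₂ zero)
    far    : ¬ Close a b → Case a b (old (δ (collapse a) (collapse b)))

  case-of : ∀ a b → Case a b (graft a b)
  case-of zero    zero    = corner refl refl
  case-of zero    (suc w) with below? x w
  ... | yes w∈ = innerʳ refl refl w∈
  ... | no  w∉ = far (λ (_ , _ , w∈) → w∉ w∈)
  case-of (suc w) zero    with below? x w
  ... | yes w∈ = innerˡ refl refl w∈
  ... | no  w∉ = subst (Case (suc w) zero) (cong old (symmetric w r))
                       (far (λ (_ , w∈ , _) → w∉ w∈))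
  case-of (suc u) (suc v) = far λ where
    (inj₁ () , _)
    (inj₂ () , _)

  graft-symmetric : ∀ a b → graft a b ≡ graft b a
  graft-symmetric zero    zero    = refl
  graft-symmetric zero    (suc w) = refl
  graft-symmetric (suc w) zero    = refl
  graft-symmetric (suc u) (suc v) = cong old (symmetric u v)

  far⁻¹ : ∀ {a b y} → graft a b ≡ old y → ¬ Close a b × δ (collapse a) (collapse b) ≡ y
  far⁻¹ {a} {b} eq with graft a b | case-of a b
  ... | _ | corner _ _   = contradiction (sym eq) old≢leaf
  ... | _ | innerʳ _ _ _ = contradiction (sym eq) old≢inner
  ... | _ | innerˡ _ _ _ = contradiction (sym eq) old≢inner
  ... | _ | far ¬close   = ¬close , old-injective eq

  graft-far : ∀ {a b} → ¬ Close a b → graft a b ≡ old (δ (collapse a) (collapse b))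
  graft-far {a} {b} ¬close with graft a b | case-of a b
  ... | _ | corner refl refl    = contradiction (inj₁ refl , r∈S , r∈S) ¬close
  ... | _ | innerʳ refl refl s∈ = contradiction (inj₁ refl , r∈S , s∈) ¬close
  ... | _ | innerˡ refl refl s∈ = contradiction (inj₂ refl , s∈ , r∈S) ¬close
  ... | _ | far _               = refl

  inner⁻¹ : ∀ {a b} → graft a b ≡ inj₂ zero →
            (a ≡ zero × ∃[ s ] b ≡ suc s × s ∈ S) ⊎ (b ≡ zero × ∃[ s ] a ≡ suc s × s ∈ S)
  inner⁻¹ {a} {b} eq with graft a b | case-of a b
  ... | _ | innerʳ a≡ b≡ s∈ = inj₁ (a≡ , _ , b≡ , s∈)
  ... | _ | innerˡ a≡ b≡ s∈ = inj₂ (b≡ , _ , a≡ , s∈)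
  ... | _ | far _           = contradiction eq old≢inner

  corner⁻¹ : ∀ {a b} → graft a b ≡ inj₁ zero → a ≡ zero × b ≡ zero
  corner⁻¹ {a} {b} eq with graft a b | case-of a b
  ... | _ | corner a≡ b≡ = a≡ , b≡
  ... | _ | far _        = contradiction eq old≢leaf

  collapse-injective : ∀ {a b} → ¬ Close a b → collapse a ≡ collapse b → a ≡ b
  collapse-injective {zero}  {zero}  _      _    = refl
  collapse-injective {zero}  {suc _} ¬close refl = contradiction (inj₁ refl , r∈S , r∈S) ¬close
  collapse-injective {suc _} {zero}  ¬close refl = contradiction (inj₂ refl , r∈S , r∈S) ¬close
  collapse-injective {suc _} {suc _} _      eq   = cong suc eq

  -- For a triangle on the new leaf and `v`, `w`: if both are in `S`, the new colour repeats; if one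
  -- is, homogeneity of `S` applies; if neither is, the triangle `r`, `v`, `w` decides. The other
  -- positions of `zero` follow by symmetry.
  graft-triangle : ∀ a b c → TwoEqual (graft a b) (graft b c) (graft a c)
  graft-triangle zero    zero    c       = inj₂ (inj₁ refl)
  graft-triangle zero    (suc v) zero    = inj₁ refl
  graft-triangle (suc u) zero    zero    = inj₂ (inj₂ refl)
  graft-triangle zero    (suc v) (suc w) with below? x v | below? x w
  ... | yes _  | yes _  = inj₂ (inj₂ refl)
  ... | yes v∈ | no  w∉ = inj₂ (inj₁ (cong old (below-homogeneous x v∈ r∈S w∉)))
  ... | no  v∉ | yes w∈ = inj₁ (cong old (trans (below-homogeneous x r∈S w∈ v∉) (symmetric w v)))
  ... | no  _  | no  _  with triangle r v w
  ...   | inj₁ eq        = inj₁ (cong old eq)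
  ...   | inj₂ (inj₁ eq) = inj₂ (inj₁ (cong old eq))
  ...   | inj₂ (inj₂ eq) = inj₂ (inj₂ (cong old eq))
  graft-triangle (suc u) zero    (suc w) with graft-triangle zero (suc u) (suc w)
  ... | inj₁ eq        = inj₂ (inj₂ eq)
  ... | inj₂ (inj₁ eq) = inj₂ (inj₁ (sym eq))
  ... | inj₂ (inj₂ eq) = inj₁ eq
  graft-triangle (suc u) (suc v) zero    with graft-triangle zero (suc u) (suc v)
  ... | inj₁ eq        = inj₂ (inj₂ (sym eq))
  ... | inj₂ (inj₁ eq) = inj₁ eq
  ... | inj₂ (inj₂ eq) = inj₂ (inj₁ (sym eq))
  graft-triangle (suc u) (suc v) (suc w) with triangle u v w
  ... | inj₁ eq        = inj₁ (cong old eq)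
  ... | inj₂ (inj₁ eq) = inj₂ (inj₁ (cong old eq))
  ... | inj₂ (inj₂ eq) = inj₂ (inj₂ (cong old eq))

  graft-loop : ∀ a → graft a a ≡ inj₁ a
  graft-loop zero    = refl
  graft-loop (suc u) = cong old (loop u)

  graft-leaf : ∀ {a b c} → graft a b ≡ inj₁ c → a ≡ c
  graft-leaf {c = zero}          eq = proj₁ (corner⁻¹ eq)
  graft-leaf {a} {b} {c = suc w} eq =
    let (¬close , ab) = far⁻¹ {a} {b} {inj₁ w} eq
        a≡w           = leaf ab
        b≡w           = leaf (trans (symmetric (collapse b) (collapse a)) ab)
    in unclose a ¬close (trans a≡w (sym b≡w)) a≡w
    where
    unclose : ∀ a {b} → ¬ Close a b → collapse a ≡ collapse b → collapse a ≡ w → a ≡ suc w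
    unclose (suc _)     _      _   a≡w = cong suc a≡w
    unclose zero    {b} ¬close a≡b _   =
      contradiction (inj₁ refl , r∈S , subst S a≡b r∈S) ¬close

  -- The new colour forms a star at the new leaf and so contains no triangle. For an old colour all
  -- three pairs are far, and `collapse` reduces to `noMono`.
  graft-noMono : ∀ {a b c} → graft a b ≡ graft b c → graft a b ≡ graft a c → a ≡ b
  graft-noMono {a} {b} {c} ab≡bc ab≡ac with graft a b in ab | case-of a b
  ... | _ | corner a≡ b≡ = trans a≡ (sym b≡)
  ... | _ | innerʳ refl refl s∈ with inner⁻¹ {suc _} {c} (sym ab≡bc)
  ...   | inj₂ (refl , _) = case ab≡ac of λ ()
  graft-noMono {a} {b} {c} ab≡bc ab≡ac | _ | innerˡ refl refl s∈
    with inner⁻¹ {suc _} {c} (sym ab≡ac)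
  ...   | inj₂ (refl , _) = case ab≡bc of λ ()
  graft-noMono {a} {b} {c} ab≡bc ab≡ac | _ | far ¬close =
    collapse-injective ¬close
      (noMono (sym (proj₂ (far⁻¹ {b} {c} (sym ab≡bc))))
              (sym (proj₂ (far⁻¹ {a} {c} (sym ab≡ac)))))

  -- If a and u are close and connected through the colour of a far pair, then
  -- the whole colour class lies in S, and the pair was close.
  far-step : ∀ {a b u w} → ¬ Close a b → ¬ Close u w →
             δ (collapse a) (collapse b) ≡ δ (collapse u) (collapse w) →
             δ (collapse a) (collapse u) ≡ δ (collapse a) (collapse b) → ¬ Close a u
  far-step {a} {b} {u} {w} ¬ab ¬uw ab≡uw au≡ab (zero∈ , a∈ , u∈) =
    [ (λ a≡ → ¬ab (inj₁ a≡ , a∈ , b∈)) , (λ u≡ → ¬uw (inj₁ u≡ , u∈ , w∈)) ]′ zero∈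
    where
    hull : Below δ (δ (collapse a) (collapse u)) ⊆ S
    hull = below-least (below? x) (below-homogeneous x) a∈ u∈
    b∈ : collapse b ∈ S
    b∈ = hull (collapse a , trans (symmetric _ _) (sym au≡ab))
    w∈ : collapse w ∈ S
    w∈ = hull (collapse u , trans (symmetric _ _) (sym (trans au≡ab ab≡uw)))

  -- A star is connected, which settles the new colour. An old colour inherits connectedness through
  -- `collapse`, once `far-step` shows that the connecting pair is far.
  graft-connected : ∀ {a b u w} → graft a b ≡ graft u w →
                    graft a u ≡ graft a b ⊎ graft a w ≡ graft a b
  graft-connected {a} {b} {u} {w} ab≡uw with graft a b in ab | case-of a b
  ... | _ | corner refl refl with corner⁻¹ {u} {w} (sym ab≡uw)
  ...   | refl , refl = inj₁ refl
  graft-connected {a} {b} {u} {w} ab≡uw | _ | innerʳ refl refl s∈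
    with inner⁻¹ {u} {w} (sym ab≡uw)
  ...   | inj₁ (_ , _ , refl , t∈) = inj₂ (attach-∈ t∈)
  ...   | inj₂ (_ , _ , refl , t∈) = inj₁ (attach-∈ t∈)
  graft-connected {a} {b} {u} {w} ab≡uw | _ | innerˡ refl refl s∈
    with inner⁻¹ {u} {w} (sym ab≡uw)
  ...   | inj₁ (refl , _) = inj₁ (attach-∈ s∈)
  ...   | inj₂ (refl , _) = inj₂ (attach-∈ s∈)
  graft-connected {a} {b} {u} {w} ab≡uw | _ | far ¬ab with far⁻¹ {u} {w} (sym ab≡uw)
  ... | ¬uw , uw≡ab with connected (sym uw≡ab)
  ...   | inj₁ au = inj₁ (trans (graft-far (far-step ¬ab ¬uw (sym uw≡ab) au)) (cong old au))
  ...   | inj₂ aw = inj₂ (trans (graft-far (far-step ¬ab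
                      (λ (z∈ , w∈ , u∈) → ¬uw (swap z∈ , u∈ , w∈))
                      (trans (sym uw≡ab) (symmetric _ _)) aw)) (cong old aw))

  graft-surjective : ∀ y → ∃[ a ] ∃[ b ] graft a b ≡ y
  graft-surjective (inj₁ zero)    = zero , zero , refl
  graft-surjective (inj₂ zero)    = zero , suc r , attach-∈ r∈S
  graft-surjective (inj₁ (suc u)) =
    let (a , b , ab) = surjective (inj₁ u) in suc a , suc b , cong old ab
  graft-surjective (inj₂ (suc i)) =
    let (a , b , ab) = surjective (inj₂ i) in suc a , suc b , cong old ab

  graft-isTree : IsTree graft
  graft-isTree = record
    { symmetric  = graft-symmetric
    ; triangle   = graft-triangle
    ; loop       = graft-loop
    ; leaf       = λ {a} {b} → graft-leaf {a} {b}
    ; noMono     = λ {a} {b} {c} → graft-noMono {a} {b} {c}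
    ; connected  = λ {a} {b} {u} {w} → graft-connected {a} {b} {u} {w}
    ; surjective = graft-surjective
    }

-- Codes of trees and their injectivity.

-- A tree on the leaves 0, …, m is built by adding its leaves in decreasing
-- order, each by subdividing the edge above some node of the previous tree.
Code : ℕ → Set
Code zero    = ⊤
Code (suc m) = Node m × Code m

tree : ∀ {m} → Code m → ∃[ δ ] IsTree {m} δ
tree {zero} _ = (λ _ _ → inj₁ zero) , record
  { symmetric  = λ _ _ → refl
  ; triangle   = λ _ _ _ → inj₁ refl
  ; loop       = λ { zero → refl }
  ; leaf       = λ { {zero} {w = zero} _ → refl }
  ; noMono     = λ { {zero} {zero} _ _ → refl }
  ; connected  = λ _ → inj₁ refl
  ; surjective = λ { (inj₁ zero) → zero , zero , refl }
  }
tree {suc m} (x , c) = graft , graft-isTree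
  where open Graft (proj₂ (tree c)) x

lca : ∀ {m} → Code m → Fin (suc m) → Fin (suc m) → Node m
lca c = proj₁ (tree c)

-- Colourings matter only up to renaming of colours: mutual `⊑` says that both induce the same
-- partition of the pairs.
_⊑_ : {V K L : Set} → (V → V → K) → (V → V → L) → Set
γ ⊑ δ = ∀ a b c d → γ a b ≡ γ c d → δ a b ≡ δ c d

-- If `w` is below `x` but not below `y`, then grafting at `y` gives the pair of the new leaf and
-- `w` the colour of an old pair, while grafting at `x` gives it the new colour, which no old pair
-- has.
graft-⊑⇒below-⊆ : ∀ {m δ} (isTree : IsTree {m} δ) (x y : Node m) →
                  Graft.graft isTree y ⊑ Graft.graft isTree x → Below δ x ⊆ Below δ y
graft-⊑⇒below-⊆ isTree x y y⊑x {w} w∈ with TreeProperties.below? isTree y w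
... | yes w∈y = w∈y
... | no  w∉y = contradiction
  (trans (sym (y⊑x zero (suc w) (suc Y.r) (suc w) (Y.attach-∉ Y.r∈S w∉y))) (X.attach-∈ w∈))
  old≢inner
  where
  module X = Graft isTree x
  module Y = Graft isTree y

⊑-restrict : ∀ {m} (c d : Code (suc m)) → lca c ⊑ lca d → lca (proj₂ c) ⊑ lca (proj₂ d)
⊑-restrict _ _ c⊑d u v w z eq =
  old-injective (c⊑d (suc u) (suc v) (suc w) (suc z) (cong old eq))

-- Deleting the last added leaf recovers the smaller code; the leaves joined to it by the new colour
-- recover the grafting node.
lca-injective : ∀ {m} (c d : Code m) → lca c ⊑ lca d → lca d ⊑ lca c → c ≡ d
lca-injective {zero}  _       _       _   _   = refl
lca-injective {suc m} (x , c) (y , d) c⊑d d⊑c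
  with lca-injective c d (⊑-restrict (x , c) (y , d) c⊑d) (⊑-restrict (y , d) (x , c) d⊑c)
... | refl = cong (_, c) (below-injective
  (graft-⊑⇒below-⊆ isTree x y d⊑c , graft-⊑⇒below-⊆ isTree y x c⊑d))
  where
  isTree = proj₂ (tree c)
  open TreeProperties isTree

-- Colour counts under deletion of a vertex.

-- Only a lower bound: further colours may be attained.
HasColours : {V K : Set} → (V → V → K) → ℕ → Set
HasColours {V} {K} γ N =
  Σ[ f ∈ (Fin N → K) ] Injective _≡_ _≡_ f × (∀ i → ∃[ u ] ∃[ v ] γ u v ≡ f i)

module _ {V K : Set} (_≟ᴷ_ : DecidableEquality K) {γ : V → V → K} where

  -- If `k` is not listed, the first entry is dropped instead, to reach the exact length. The last
  -- component ensures that a colour avoided earlier stays avoided when the lemma is applied again.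
  avoid : ∀ {N} k → ((f , _) : HasColours γ (suc N)) →
          Σ[ (g , _) ∈ HasColours γ N ] (∀ i → g i ≢ k) × (∀ i → ∃[ j ] g i ≡ f j)
  avoid k (f , f-inj , attained) with Fin.any? (λ i → f i ≟ᴷ k)
  ... | yes (i , fi≡k) =
    (f ∘ punchIn i , Fin.punchIn-injective i _ _ ∘ f-inj , attained ∘ punchIn i) ,
    (λ j fj≡k → Fin.punchInᵢ≢i i j (f-inj (trans fj≡k (sym fi≡k)))) , λ j → punchIn i j , refl
  ... | no  ∄i =
    (f ∘ suc , Fin.suc-injective ∘ f-inj , attained ∘ suc) ,
    (λ j fj≡k → ∄i (suc j , fj≡k)) , λ j → suc j , refl

module Restrict {m} {K : Set} (_≟ᴷ_ : DecidableEquality K)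
                {γ : Fin (suc (suc m)) → Fin (suc (suc m)) → K}
                (isGallai : IsGallaiColouring γ) where

  open IsGallaiColouring isGallai

  γ⁻ : Fin (suc m) → Fin (suc m) → K
  γ⁻ u v = γ (suc u) (suc v)

  restrict-isGallai : IsGallaiColouring γ⁻
  restrict-isGallai = record
    { symmetric = λ u v → symmetric (suc u) (suc v)
    ; triangle  = λ u v w → triangle (suc u) (suc v) (suc w)
    ; loop      = Fin.suc-injective ∘ loop
    }

  Old : Pred K 0ℓ
  Old k = ∃[ u ] ∃[ v ] γ⁻ u v ≡ k

  old? : Decidable Old
  old? k = Fin.any? (λ u → Fin.any? (λ v → γ⁻ u v ≟ᴷ k))

  New : Pred (Fin (suc m)) 0ℓ
  New w = γ zero (suc w) ∉ Old

  new? : Decidable New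
  new? w = ¬? (old? (γ zero (suc w)))

  -- The edge `vw` has an old colour, so two different new colours would make the triangle on
  -- `zero`, `v`, `w` rainbow.
  new-unique : ∀ {v w} → v ∈ New → w ∈ New → γ zero (suc v) ≡ γ zero (suc w)
  new-unique {v} {w} v∈ w∈ with triangle zero (suc v) (suc w)
  ... | inj₁ eq        = contradiction (v , w , sym eq) v∈
  ... | inj₂ (inj₁ eq) = contradiction (v , w , eq) w∈
  ... | inj₂ (inj₂ eq) = eq

  at-zero : ∀ {k} w → γ zero (suc w) ≡ k → k ∈ Old ⊎ ∃[ w ] w ∈ New × γ zero (suc w) ≡ k
  at-zero w refl with old? (γ zero (suc w))
  ... | yes isOld = inj₁ isOld
  ... | no  isNew = inj₂ (w , isNew , refl)

  old-or-new : ∀ {k} a b → γ a b ≡ k → k ≢ γ zero zero →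
               k ∈ Old ⊎ ∃[ w ] w ∈ New × γ zero (suc w) ≡ k
  old-or-new zero    zero    eq k≢ = contradiction (sym eq) k≢
  old-or-new (suc u) (suc v) eq k≢ = inj₁ (u , v , eq)
  old-or-new zero    (suc w) eq k≢ = at-zero w eq
  old-or-new (suc w) zero    eq k≢ = at-zero w (trans (symmetric _ _) eq)

  restrict-colours : ∀ {N} → (∀ w → w ∉ New) → HasColours γ (suc N) → HasColours γ⁻ N
  restrict-colours ∄new cs with avoid _≟ᴷ_ (γ zero zero) cs
  ... | (g , g-inj , attained) , g≢loop , _ = g , g-inj , λ i →
    let (a , b , ab) = attained i in
    case old-or-new a b ab (g≢loop i) of λ where
      (inj₁ isOld)         → isOld
      (inj₂ (w , w∈ , _)) → contradiction w∈ (∄new w)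

  -- Deleting a vertex loses its loop colour and, by `new-unique`, at most one more.
  restrict-colours₂ : ∀ {N} → HasColours γ (suc (suc N)) → HasColours γ⁻ N
  restrict-colours₂ cs with Fin.any? new?
  -- Here only the loop colour is lost; `avoid` is applied once more merely to shorten the list.
  ... | no ∄new = restrict-colours (λ w w∈ → ∄new (w , w∈))
                    (proj₁ (avoid _≟ᴷ_ (γ zero zero) cs))
  ... | yes (w , w∈) with avoid _≟ᴷ_ (γ zero (suc w)) cs
  ...   | cs′@(f , _) , f≢new , _ with avoid _≟ᴷ_ (γ zero zero) cs′
  ...     | (g , g-inj , attained) , g≢loop , f∋g = g , g-inj , λ i →
    let (a , b , ab) = attained i
        (j , gi≡fj)  = f∋g i
    in case old-or-new a b ab (g≢loop i) of λ where
      (inj₁ isOld)         → isOld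
      (inj₂ (v , v∈ , eq)) →
        contradiction (trans (sym gi≡fj) (trans (sym eq) (new-unique v∈ w∈))) (f≢new j)

nodes-suc : ∀ m → suc (suc m) + suc m ≡ suc (suc (suc m + m))
nodes-suc m = cong (λ k → suc (suc k)) (ℕ.+-suc m m)

module _ {K : Set} (_≟ᴷ_ : DecidableEquality K) where

  -- A single vertex carries only its loop colour, and each further vertex adds at most two colours.
  -- With `suc m` loops this leaves at most `m` colours for proper edges.
  colours-bound : ∀ {m} {γ : Fin (suc m) → Fin (suc m) → K} → IsGallaiColouring γ →
                  ¬ HasColours γ (suc (suc m + m))
  colours-bound {zero} {γ} _ (f , f-inj , attained) with attained zero | attained (suc zero)
  ... | zero , zero , eq₀ | zero , zero , eq₁ = case f-inj (trans (sym eq₀) eq₁) of λ ()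
  colours-bound {suc m} {γ} isGallai cs =
    colours-bound restrict-isGallai
      (restrict-colours₂ (subst (HasColours γ) (cong suc (nodes-suc m)) cs))
    where open Restrict _≟ᴷ_ isGallai

  -- Recovering the tree of a maximal colouring.

  toCode : ∀ {m} {γ : Fin (suc m) → Fin (suc m) → K} → IsGallaiColouring γ →
           HasColours γ (suc m + m) → ∃[ c ] γ ⊑ lca {m} c × lca {m} c ⊑ γ
  toCode {zero} {γ} _ _ = tt , (λ _ _ _ _ _ → refl) , λ { zero zero zero zero _ → refl }
  toCode {suc m} {γ} isGallai cs with Fin.any? (Restrict.new? _≟ᴷ_ isGallai)
  -- Without a new colour only the loop is lost, and the smaller colouring would exceed its bound.
  ... | no ∄new = contradiction
    (restrict-colours (λ w w∈ → ∄new (w , w∈)) (subst (HasColours γ) (nodes-suc m) cs))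
    (colours-bound restrict-isGallai)
    where open Restrict _≟ᴷ_ isGallai
  ... | yes (n , n∈) =
    (x , c) , (λ a b d e → proj₁ (match-⇔ (match a b) (match d e)))
            , (λ a b d e → proj₂ (match-⇔ (match a b) (match d e)))
    where
    open Restrict _≟ᴷ_ isGallai
    open IsGallaiColouring isGallai
    smaller = toCode restrict-isGallai
                (restrict-colours₂ (subst (HasColours γ) (nodes-suc m) cs))
    c : Code m
    c = proj₁ smaller
    γ⁻⊑c : γ⁻ ⊑ lca c
    γ⁻⊑c = proj₁ (proj₂ smaller)
    c⊑γ⁻ : lca c ⊑ γ⁻
    c⊑γ⁻ = proj₂ (proj₂ smaller)
    open TreeProperties (proj₂ (tree c))

    p : K
    p = γ zero (suc n)

    Q : Pred (Fin (suc m)) 0ℓ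
    Q w = γ zero (suc w) ≡ p

    -- In the triangle on `zero`, `s`, `w`, the edge to `s` has colour `p`, and the other two do
    -- not: one since `p` is new, one since `w ∉ Q`. So these two agree.
    outside : ∀ {s w} → s ∈ Q → w ∉ Q → γ zero (suc w) ≡ γ⁻ s w
    outside {s} {w} s∈ w∉ with triangle zero (suc s) (suc w)
    ... | inj₁ eq        = contradiction (s , w , trans (sym eq) s∈) n∈
    ... | inj₂ (inj₁ eq) = sym eq
    ... | inj₂ (inj₂ eq) = contradiction (trans (sym eq) s∈) w∉

    below : ∃[ x ] Q ≐ Below (lca c) x
    below = homogeneous⇒below (λ w → γ zero (suc w) ≟ᴷ p)
      -- Both colours equal that of the edge from `zero` to `w`, whence homogeneity. The final
      -- `refl` is the membership of `n` in `Q`.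
      (λ s∈ t∈ w∉ → γ⁻⊑c _ _ _ _ (trans (sym (outside s∈ w∉)) (outside t∈ w∉))) refl

    x : Node m
    x = proj₁ below

    open Graft (proj₂ (tree c)) x

    -- The renaming of colours, kept as a relation so that both directions of `⊑` come from one case
    -- analysis.
    data Match : K → Node (suc m) → Set where
      corner : Match (γ zero zero) (inj₁ zero)
      inner  : Match p (inj₂ zero)
      both   : ∀ u v → Match (γ⁻ u v) (old (lca c u v))

    match-attach : ∀ w → Match (γ zero (suc w)) (attach w)
    match-attach w with γ zero (suc w) ≟ᴷ p
    ... | yes w∈ = subst₂ Match (sym w∈) (sym (attach-∈ (proj₁ (proj₂ below) w∈))) inner
    ... | no  w∉ = subst₂ Match (sym (outside (proj₂ (proj₂ below) r∈S) w∉))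
      (sym (attach-∉ r∈S (w∉ ∘ proj₂ (proj₂ below)))) (both r w)

    match : ∀ a b → Match (γ a b) (graft a b)
    match zero    zero    = corner
    match zero    (suc w) = match-attach w
    match (suc w) zero    = subst (λ k → Match k (attach w)) (symmetric _ _) (match-attach w)
    match (suc u) (suc v) = both u v

    -- The three kinds never coincide: the loop colour occurs only at its loop, and `p` is not old.
    -- Among old colours the induction hypothesis applies.
    match-⇔ : ∀ {k y k′ y′} → Match k y → Match k′ y′ → (k ≡ k′ → y ≡ y′) × (y ≡ y′ → k ≡ k′)
    match-⇔ corner     corner       = (λ _ → refl) , λ _ → refl
    match-⇔ corner     inner        = (λ eq → case loopʳ eq of λ ()) , λ ()
    match-⇔ corner     (both _ _)   =
      (λ eq → case loop eq of λ ()) , λ eq → contradiction (sym eq) old≢leaf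
    match-⇔ inner      corner       = (λ eq → case loopʳ (sym eq) of λ ()) , λ ()
    match-⇔ inner      inner        = (λ _ → refl) , λ _ → refl
    match-⇔ inner      (both u v)   =
      (λ eq → contradiction (u , v , sym eq) n∈) , λ eq → contradiction (sym eq) old≢inner
    match-⇔ (both _ _) corner       =
      (λ eq → case loop (sym eq) of λ ()) , λ eq → contradiction eq old≢leaf
    match-⇔ (both u v) inner        =
      (λ eq → contradiction (u , v , eq) n∈) , λ eq → contradiction eq old≢inner
    match-⇔ (both u v) (both u′ v′) =
      (cong old ∘ γ⁻⊑c u v u′ v′) , (c⊑γ⁻ u v u′ v′ ∘ old-injective)

-- From Gallai partitions to colourings.

link : ∀ {n} → Fin n → Fin n → Fin n ⊎ Edge n
link u v with Fin.<-cmp u v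
... | tri< u<v _ _ = inj₂ (edge u v u<v)
... | tri≈ _ _ _   = inj₁ u
... | tri> _ _ v<u = inj₂ (edge v u v<u)

joins-sym : ∀ {n} (e : Edge n) {u v} → e Joins u and v → e Joins v and u
joins-sym _ (inj₁ (u≡ , v≡)) = inj₂ (v≡ , u≡)
joins-sym _ (inj₂ (u≡ , v≡)) = inj₁ (v≡ , u≡)

link-joins : ∀ {n} (e : Edge n) {u v} → e Joins u and v → link u v ≡ inj₂ e
link-joins (edge lo hi lo<hi) (inj₁ (refl , refl)) with Fin.<-cmp lo hi
... | tri< _ _ _    = refl
... | tri≈ lo≮hi _ _ = contradiction-irr lo<hi lo≮hi
... | tri> lo≮hi _ _ = contradiction-irr lo<hi lo≮hi
link-joins (edge lo hi lo<hi) (inj₂ (refl , refl)) with Fin.<-cmp hi lo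
... | tri< _ _ lo≮hi = contradiction-irr lo<hi lo≮hi
... | tri≈ _ _ lo≮hi = contradiction-irr lo<hi lo≮hi
... | tri> _ _ _    = refl

link-loop : ∀ {n} (u : Fin n) → link u u ≡ inj₁ u
link-loop u with Fin.<-cmp u u
... | tri< _ u≢u _ = contradiction refl u≢u
... | tri≈ _ _ _   = refl
... | tri> _ u≢u _ = contradiction refl u≢u

equal-or-joined : ∀ {n} (u v : Fin n) → u ≡ v ⊎ ∃[ e ] e Joins u and v
equal-or-joined u v with Fin.<-cmp u v
... | tri< u<v _ _ = inj₂ (edge u v u<v , inj₁ (refl , refl))
... | tri≈ _ u≡v _ = inj₁ u≡v
... | tri> _ _ v<u = inj₂ (edge v u v<u , inj₂ (refl , refl))

joined : ∀ {n} {u v : Fin n} → u ≢ v → ∃[ e ] e Joins u and v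
joined {u = u} {v} u≢v =
  [ (λ u≡v → contradiction u≡v u≢v) , (λ e → e) ]′ (equal-or-joined u v)

joins-distinct : ∀ {n} (e : Edge n) {u v} → e Joins u and v → u ≢ v
joins-distinct (edge _ _ lo<hi) (inj₁ (refl , refl)) eq =
  contradiction-irr lo<hi (Fin.<-irrefl eq)
joins-distinct (edge _ _ lo<hi) (inj₂ (refl , refl)) eq =
  contradiction-irr lo<hi (Fin.<-irrefl (sym eq))

module _ {A : Set} {k : ℕ} (P : Partition A k) where

  open Partition P

  colour : A → Fin k
  colour a = proj₁ (cover a)

  ∈-colour : ∀ a → a ∈ block (colour a)
  ∈-colour a = proj₂ (cover a)

  ∈⇒colour : ∀ {a i} → a ∈ block i → colour a ≡ i
  ∈⇒colour {a} {i} a∈ with colour a Fin.≟ i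
  ... | yes eq = eq
  ... | no  ≢i = contradiction (∈-colour a , a∈) (disjoint ≢i)

module _ {n k : ℕ} (P : Partition (Edge n) k) where

  open Partition P

  colouring : Fin n → Fin n → Fin n ⊎ Fin k
  colouring u v = map₂ (colour P) (link u v)

  colouring-joins : ∀ e {u v} → e Joins u and v → colouring u v ≡ inj₂ (colour P e)
  colouring-joins e = cong (map₂ (colour P)) ∘ link-joins e

  colouring-edge : ∀ e → colouring (Edge.lo e) (Edge.hi e) ≡ inj₂ (colour P e)
  colouring-edge e = colouring-joins e (inj₁ (refl , refl))

  colouring-loop : ∀ u → colouring u u ≡ inj₁ u
  colouring-loop = cong (map₂ (colour P)) ∘ link-loop

  colouring-symmetric : ∀ u v → colouring u v ≡ colouring v u
  colouring-symmetric u v with equal-or-joined u v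
  ... | inj₁ refl    = refl
  ... | inj₂ (e , j) = trans (colouring-joins e j) (sym (colouring-joins e (joins-sym e j)))

  colouring-loop⁻¹ : ∀ {u v w} → colouring u u ≡ colouring v w → u ≡ v × v ≡ w
  colouring-loop⁻¹ {u} {v} {w} eq with equal-or-joined v w
  ... | inj₁ refl    =
    inj₁-injective (trans (sym (colouring-loop u)) (trans eq (colouring-loop v))) , refl
  ... | inj₂ (e , j) =
    case trans (sym (colouring-loop u)) (trans eq (colouring-joins e j)) of λ ()

  -- The `n` loops and the `k` blocks; for `n = suc k` this is the extremal count required by
  -- `toCode`.
  colouring-colours : HasColours colouring (n + k)
  colouring-colours = splitAt n , splitAt-injective , attained
    where
    splitAt-injective : Injective _≡_ _≡_ (splitAt n {k})
    splitAt-injective {i} {j} eq =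
      trans (sym (Fin.join-splitAt n k i)) (trans (cong (join n k) eq) (Fin.join-splitAt n k j))
    attained : ∀ i → ∃[ u ] ∃[ v ] colouring u v ≡ splitAt n i
    attained i with splitAt n i
    ... | inj₁ u = u , u , colouring-loop u
    ... | inj₂ b = let (e , e∈) = nonempty b in
      Edge.lo e , Edge.hi e , trans (colouring-edge e) (cong inj₂ (∈⇒colour P e∈))

  module _ (isGallai : IsGallai P) where

    triangle-distinct : ∀ {u v w} → u ≢ v → v ≢ w → u ≢ w →
                        TwoEqual (colouring u v) (colouring v w) (colouring u w)
    triangle-distinct {u} {v} {w} u≢v v≢w u≢w = result
      where
      e₀ = joined u≢v
      e₁ = joined v≢w
      e₂ = joined (u≢w ∘ sym)
      -- The cycle closes from `w` to `u`, so its third edge is reversed for comparison with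
      -- `colouring u w`.
      e₂⁻¹ = proj₁ e₂ , joins-sym (proj₁ e₂) (proj₂ e₂)

      vertex : Fin 3 → Fin n
      vertex zero             = u
      vertex (suc zero)       = v
      vertex (suc (suc zero)) = w

      vertex-injective : Injective _≡_ _≡_ vertex
      vertex-injective {zero}           {zero}           _  = refl
      vertex-injective {zero}           {suc zero}       eq = contradiction eq u≢v
      vertex-injective {zero}           {suc (suc zero)} eq = contradiction eq u≢w
      vertex-injective {suc zero}       {zero}           eq = contradiction (sym eq) u≢v
      vertex-injective {suc zero}       {suc zero}       _  = refl
      vertex-injective {suc zero}       {suc (suc zero)} eq = contradiction eq v≢w
      vertex-injective {suc (suc zero)} {zero}           eq = contradiction (sym eq) u≢w
      vertex-injective {suc (suc zero)} {suc zero}       eq = contradiction (sym eq) v≢w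
      vertex-injective {suc (suc zero)} {suc (suc zero)} _  = refl

      C : Cycle n
      C = record
        { length-3 = 0
        ; vertexAt = vertex
        ; edgeAt   = λ { zero → proj₁ e₀ ; (suc zero) → proj₁ e₁ ; (suc (suc zero)) → proj₁ e₂ }
        ; distinct = vertex-injective
        ; joins    = λ { zero → proj₂ e₀ ; (suc zero) → proj₂ e₁ ; (suc (suc zero)) → proj₂ e₂ }
        }

      via : ∀ {a b c d} ((e , _) : ∃[ e ] e Joins a and b) ((f , _) : ∃[ f ] f Joins c and d) →
            colour P e ≡ colour P f → colouring a b ≡ colouring c d
      via (e , je) (f , jf) eq =
        trans (colouring-joins e je) (trans (cong inj₂ eq) (sym (colouring-joins f jf)))

      decide : ∀ i j → Cycle.edgeAt C i ≢ Cycle.edgeAt C j →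
               colour P (Cycle.edgeAt C i) ≡ colour P (Cycle.edgeAt C j) →
               TwoEqual (colouring u v) (colouring v w) (colouring u w)
      decide zero             zero             ≢ _  = contradiction refl ≢
      decide zero             (suc zero)       _ eq = inj₁ (via e₀ e₁ eq)
      decide zero             (suc (suc zero)) _ eq = inj₂ (inj₂ (via e₀ e₂⁻¹ eq))
      decide (suc zero)       zero             _ eq = inj₁ (via e₀ e₁ (sym eq))
      decide (suc zero)       (suc zero)       ≢ _  = contradiction refl ≢
      decide (suc zero)       (suc (suc zero)) _ eq = inj₂ (inj₁ (via e₁ e₂⁻¹ eq))
      decide (suc (suc zero)) zero             _ eq = inj₂ (inj₂ (via e₀ e₂⁻¹ (sym eq)))
      decide (suc (suc zero)) (suc zero)       _ eq = inj₂ (inj₁ (via e₁ e₂⁻¹ (sym eq)))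
      decide (suc (suc zero)) (suc (suc zero)) ≢ _  = contradiction refl ≢

      result : TwoEqual (colouring u v) (colouring v w) (colouring u w)
      result with isGallai C
      ... | _ , _ , e≢f , (i , refl) , (j , refl) , b , e∈ , f∈ =
        decide i j e≢f (trans (∈⇒colour P e∈) (sym (∈⇒colour P f∈)))

    colouring-triangle : ∀ u v w → TwoEqual (colouring u v) (colouring v w) (colouring u w)
    colouring-triangle u v w with u Fin.≟ v | v Fin.≟ w | u Fin.≟ w
    ... | yes refl | _        | _        = inj₂ (inj₁ refl)
    ... | no _     | yes refl | _        = inj₂ (inj₂ refl)
    ... | no _     | no _     | yes refl = inj₁ (colouring-symmetric u v)
    ... | no u≢v   | no v≢w   | no u≢w   = triangle-distinct u≢v v≢w u≢w

    colouring-isGallai : IsGallaiColouring colouring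
    colouring-isGallai = record
      { symmetric = colouring-symmetric
      ; triangle  = colouring-triangle
      ; loop      = proj₁ ∘ colouring-loop⁻¹
      }

-- Equality of partitions as mutual refinement of colourings.

module _ {n k : ℕ} (P Q : Partition (Edge n) k) where

  open Partition

  -- Edges sharing a block of `P` share the matching block of `Q`; a loop shares its colour with no
  -- other pair.
  ≈⇒⊑ : P ≈ᴾ Q → colouring P ⊑ colouring Q
  ≈⇒⊑ (P⇒Q , _) a b c d eq with equal-or-joined a b
  ... | inj₁ refl with colouring-loop⁻¹ P {a} {c} {d} eq
  ...   | refl , refl = refl
  ≈⇒⊑ (P⇒Q , _) a b c d eq | inj₂ (e , je) with equal-or-joined c d
  ... | inj₁ refl with colouring-loop⁻¹ P {c} {a} {b} (sym eq)
  ...   | refl , refl = refl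
  ≈⇒⊑ (P⇒Q , _) a b c d eq | inj₂ (e , je) | inj₂ (f , jf) =
    let (j , P⊆Q , _) = P⇒Q (colour P e)
        f≡e = inj₂-injective (trans (sym (colouring-joins P f jf))
                (trans (sym eq) (colouring-joins P e je)))
        e∈  = P⊆Q (∈-colour P e)
        f∈  = P⊆Q (subst (λ i → block P i f) f≡e (∈-colour P f))
    in trans (colouring-joins Q e je)
         (trans (cong inj₂ (trans (∈⇒colour Q e∈) (sym (∈⇒colour Q f∈))))
           (sym (colouring-joins Q f jf)))

  -- Any edge of the nonempty block `i` determines the matching block of `Q`.
  ⊑⇒blocks : colouring P ⊑ colouring Q → colouring Q ⊑ colouring P →
             ∀ i → ∃[ j ] block P i ≐ block Q j
  ⊑⇒blocks P⊑Q Q⊑P i =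
    let (e , e∈) = nonempty P i in
    colour Q e ,
    (λ {f} f∈ → subst (λ j → block Q j f)
      (transfer P Q P⊑Q (trans (∈⇒colour P f∈) (sym (∈⇒colour P e∈)))) (∈-colour Q f)) ,
    (λ {f} f∈ → subst (λ j → block P j f)
      (trans (transfer Q P Q⊑P (∈⇒colour Q f∈)) (∈⇒colour P e∈)) (∈-colour P f))
    where
    transfer : ∀ (P Q : Partition (Edge n) k) {e f} → colouring P ⊑ colouring Q →
               colour P e ≡ colour P f → colour Q e ≡ colour Q f
    transfer P Q {e} {f} P⊑Q eq = inj₂-injective
      (trans (sym (colouring-edge Q e))
        (trans (P⊑Q (Edge.lo e) (Edge.hi e) (Edge.lo f) (Edge.hi f)
            (trans (colouring-edge P e) (trans (cong inj₂ eq) (sym (colouring-edge P f)))))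
          (colouring-edge Q f)))

⊑⇒≈ : ∀ {n k} (P Q : Partition (Edge n) k) →
      colouring P ⊑ colouring Q → colouring Q ⊑ colouring P → P ≈ᴾ Q
⊑⇒≈ P Q P⊑Q Q⊑P = ⊑⇒blocks P Q P⊑Q Q⊑P , ⊑⇒blocks Q P Q⊑P P⊑Q

-- From triangles to all cycles.

module _ {n : ℕ} (C : Cycle n) where

  open Cycle C

  private
    last : Fin length
    last = fromℕ (2 + length-3)

  next-inject₁ : ∀ i → next (inject₁ i) ≡ suc i
  next-inject₁ i = Fin.toℕ-injective (begin
    toℕ (next (inject₁ i))                  ≡⟨ Fin.toℕ-fromℕ< (m%n<n (suc (toℕ (inject₁ i))) length) ⟩
    suc (toℕ (inject₁ i)) % length ≡⟨ m<n⇒m%n≡m (s≤s (Fin.inject₁ℕ< i)) ⟩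
    suc (toℕ (inject₁ i))                   ≡⟨ cong suc (Fin.toℕ-inject₁ i) ⟩
    suc (toℕ i)                             ∎)
    where open ≡-Reasoning

  next-last : next last ≡ zero
  next-last = Fin.toℕ-injective (begin
    toℕ (next last)                  ≡⟨ Fin.toℕ-fromℕ< (m%n<n (suc (toℕ last)) length) ⟩
    suc (toℕ last) % length ≡⟨ cong (λ k → suc k % length) (Fin.toℕ-fromℕ (2 + length-3)) ⟩
    length % length         ≡⟨ n%n≡0 length ⟩
    0                                ∎)
    where open ≡-Reasoning

  last-or-suc : ∀ i → i ≡ last ⊎ toℕ (next i) ≡ suc (toℕ i)
  last-or-suc i with view i
  ... | ‵fromℕ     = inj₁ refl
  ... | ‵inject₁ j = inj₂ (trans (cong toℕ (next-inject₁ j)) (cong suc (sym (Fin.toℕ-inject₁ j))))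

  -- This is where the length being at least 3 enters: it excludes a return at the two positions
  -- where the cycle wraps around.
  next-next : ∀ i → next (next i) ≢ i
  next-next i eq with last-or-suc i | last-or-suc (next i)
  ... | inj₁ refl | _ = case
    trans (sym (next-inject₁ zero)) (trans (cong next (sym next-last)) eq) of λ ()
  ... | inj₂ i+1  | inj₁ n≡last = case
    trans (sym (Fin.toℕ-fromℕ _)) (trans (cong toℕ (sym n≡last)) (trans i+1
      (cong (suc ∘ toℕ) (trans (sym eq) (trans (cong next n≡last) next-last))))) of λ ()
  ... | inj₂ i+1  | inj₂ i+2 =
    ℕ.m≢1+n+m (toℕ i) {1} (trans (cong toℕ (sym eq)) (trans i+2 (cong suc i+1)))

  -- Equal edges traversed in the same direction start at the same vertex; in opposite directions
  -- they would give `next (next i) ≡ i`. Thus two positions of equal colour provide two distinct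
  -- edges.
  edgeAt-injective : Injective _≡_ _≡_ edgeAt
  edgeAt-injective {i} {j} eq
    with joins i | subst (_Joins vertexAt j and vertexAt (next j)) (sym eq) (joins j)
  ... | inj₁ (vi , _)  | inj₁ (vj , _)  = distinct (trans vi (sym vj))
  ... | inj₂ (vi , _)  | inj₂ (vj , _)  = distinct (trans vi (sym vj))
  ... | inj₁ (vi , ni) | inj₂ (vj , nj) = contradiction
    (trans (cong next (distinct (trans ni (sym vj)))) (distinct (trans nj (sym vi)))) (next-next i)
  ... | inj₂ (vi , ni) | inj₁ (vj , nj) = contradiction
    (trans (cong next (distinct (trans ni (sym vj)))) (distinct (trans nj (sym vi)))) (next-next i)

  -- Unless two edges have the same colour, the chord from vertex 0 to vertex i
  -- has the colour of one of the edges between them.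
  repeated-colour : ∀ {K : Set} {γ : Fin n → Fin n → K} → IsGallaiColouring γ →
                    ∃[ i ] ∃[ j ] i ≢ j ×
                    γ (vertexAt i) (vertexAt (next i)) ≡ γ (vertexAt j) (vertexAt (next j))
  repeated-colour {K} {γ} isGallai with <-weakInduction Chord (inj₂ (inj₁ refl)) chord-step last
    where
    open IsGallaiColouring isGallai
    γₑ : Fin length → K
    γₑ i = γ (vertexAt i) (vertexAt (next i))
    Chord : Pred (Fin length) 0ℓ
    Chord i = (∃[ i ] ∃[ j ] i ≢ j × γₑ i ≡ γₑ j) ⊎ i ≡ zero ⊎
              ∃[ j ] j < i × γ (vertexAt zero) (vertexAt i) ≡ γₑ j
    γₑ-inject₁ : ∀ i → γₑ (inject₁ i) ≡ γ (vertexAt (inject₁ i)) (vertexAt (suc i))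
    γₑ-inject₁ i = cong (λ j → γ (vertexAt (inject₁ i)) (vertexAt j)) (next-inject₁ i)
    inject₁<suc : ∀ i → inject₁ i < suc i
    inject₁<suc i = s≤s (ℕ.≤-reflexive (Fin.toℕ-inject₁ i))
    chord-step : ∀ i → Chord (inject₁ i) → Chord (suc i)
    chord-step i (inj₁ same)             = inj₁ same
    chord-step i (inj₂ (inj₁ i≡0))       = inj₂ (inj₂ (inject₁ i , inject₁<suc i ,
      sym (trans (γₑ-inject₁ i) (cong (λ j → γ (vertexAt j) (vertexAt (suc i))) i≡0))))
    chord-step i (inj₂ (inj₂ (j , j<i , chord)))
      with triangle (vertexAt zero) (vertexAt (inject₁ i)) (vertexAt (suc i))
    ... | inj₁ eq        = inj₁ (j , inject₁ i , (λ j≡i → Fin.<-irrefl j≡i j<i) ,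
                             trans (sym chord) (trans eq (sym (γₑ-inject₁ i))))
    ... | inj₂ (inj₁ eq) = inj₂ (inj₂ (inject₁ i , inject₁<suc i ,
                             sym (trans (γₑ-inject₁ i) eq)))
    ... | inj₂ (inj₂ eq) = inj₂ (inj₂ (j ,
                             Fin.<-trans {i = j} {inject₁ i} {suc i} j<i (inject₁<suc i) ,
                             trans (sym eq) chord))
  ... | inj₁ same = same
  -- The chord from vertex 0 to the last vertex is the closing edge of the cycle.
  ... | inj₂ (inj₂ (j , j<last , chord)) = j , last , (λ j≡ → Fin.<-irrefl j≡ j<last) ,
    trans (sym chord) (trans (IsGallaiColouring.symmetric isGallai _ _)
      (cong (λ i → γ (vertexAt last) (vertexAt i)) (sym next-last)))

-- From trees to Gallai partitions.

module _ {m} {δ : Fin (suc m) → Fin (suc m) → Node m} (isTree : IsTree δ) where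

  open IsTree isTree

  lca-joins : ∀ e {u v} → e Joins u and v → δ u v ≡ δ (Edge.lo e) (Edge.hi e)
  lca-joins _ (inj₁ (refl , refl)) = refl
  lca-joins _ (inj₂ (refl , refl)) = symmetric _ _

  inner-node : ∀ {u v} → u ≢ v → ∃[ i ] δ u v ≡ inj₂ i
  inner-node {u} {v} u≢v with δ u v in uv
  ... | inj₁ w = contradiction (trans (leaf uv) (sym (leaf (trans (symmetric v u) uv)))) u≢v
  ... | inj₂ i = i , refl

  treePartition : Partition (Edge (suc m)) m
  treePartition = record
    { block    = λ i e → δ (Edge.lo e) (Edge.hi e) ≡ inj₂ i
    ; nonempty = nonempty
    ; disjoint = λ { i≢j (eqᵢ , eqⱼ) → i≢j (inj₂-injective (trans (sym eqᵢ) eqⱼ)) }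
    ; cover    = λ e → inner-node (joins-distinct e (inj₁ (refl , refl)))
    }
    where
    nonempty : ∀ i → ∃[ e ] δ (Edge.lo e) (Edge.hi e) ≡ inj₂ i
    nonempty i with surjective (inj₂ i)
    ... | u , v , uv with equal-or-joined u v
    ...   | inj₁ refl    = case trans (sym (loop u)) uv of λ ()
    ...   | inj₂ (e , j) = e , trans (sym (lca-joins e j)) uv

  treePartition-isGallai : IsGallai treePartition
  treePartition-isGallai C =
    let (i , j , i≢j , eq) = repeated-colour C isGallaiColouring
        (b , eᵢ∈) = cover (edgeAt i)
    in edgeAt i , edgeAt j , i≢j ∘ edgeAt-injective C , (i , refl) , (j , refl) ,
       b , eᵢ∈ , trans (sym (lca-joins (edgeAt j) (joins j)))
                     (trans (sym eq) (trans (lca-joins (edgeAt i) (joins i)) eᵢ∈))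
    where
    open Cycle C
    open Partition treePartition

  -- An equality rather than a renaming, since loops are coloured by leaves and blocks are indexed
  -- by internal nodes.
  colouring-treePartition : ∀ u v → colouring treePartition u v ≡ δ u v
  colouring-treePartition u v with equal-or-joined u v
  ... | inj₁ refl    = trans (colouring-loop treePartition u) (sym (loop u))
  ... | inj₂ (e , j) = trans (colouring-joins treePartition e j)
    (trans (sym (∈-colour treePartition e)) (sym (lca-joins e j)))

⊑-resp : ∀ {V K L : Set} {γ γ′ : V → V → K} {δ δ′ : V → V → L} →
         (∀ u v → γ u v ≡ γ′ u v) → (∀ u v → δ u v ≡ δ′ u v) → γ ⊑ δ → γ′ ⊑ δ′
⊑-resp γ≡γ′ δ≡δ′ γ⊑δ a b c d eq = trans (sym (δ≡δ′ a b))
  (trans (γ⊑δ a b c d (trans (γ≡γ′ a b) (trans eq (sym (γ≡γ′ c d))))) (δ≡δ′ c d))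

-- The bijection with codes and the count.

codePartition : ∀ {m} → Code m → GallaiPartition (suc m) m
codePartition c = treePartition isTree , treePartition-isGallai isTree
  where isTree = proj₂ (tree c)

codePartition-injective : ∀ {m} {c d : Code m} →
  proj₁ (codePartition c) ≈ᴾ proj₁ (codePartition d) → c ≡ d
codePartition-injective {c = c} {d} c≈d = lca-injective c d
  (⊑-resp (lca-of c) (lca-of d) (≈⇒⊑ (P c) (P d) c≈d))
  (⊑-resp (lca-of d) (lca-of c) (≈⇒⊑ (P d) (P c) (Product.swap c≈d)))
  where
  P : Code _ → Partition _ _
  P = proj₁ ∘ codePartition
  lca-of : ∀ c u v → colouring (P c) u v ≡ lca c u v
  lca-of c = colouring-treePartition (proj₂ (tree c))

codePartition-surjective : ∀ {m} ((P , _) : GallaiPartition (suc m) m) →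
  ∃[ c ] proj₁ (codePartition {m} c) ≈ᴾ P
codePartition-surjective (P , isGallai) =
  let (c , P⊑c , c⊑P) = toCode _≟_ (colouring-isGallai P isGallai) (colouring-colours P)
      lca-of          = colouring-treePartition (proj₂ (tree c))
      lca-of⁻¹        = λ u v → sym (lca-of u v)
  in c , ⊑⇒≈ (proj₁ (codePartition c)) P
    (⊑-resp lca-of⁻¹ (λ _ _ → refl) c⊑P) (⊑-resp (λ _ _ → refl) lca-of⁻¹ P⊑c)

codeCount : ℕ → ℕ
codeCount zero    = 1
codeCount (suc m) = (suc m + m) * codeCount m

enumerate : ∀ m → Fin (codeCount m) ↔ Code m
enumerate zero    = mk↔ₛ′ (λ _ → tt) (λ _ → zero) (λ _ → refl) (λ { zero → refl })
enumerate (suc m) = ↔-trans Fin.*↔× (Fin.+↔⊎ ×-↔ enumerate m)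

-- The index is shifted because `n = m + 2` vertices are coded by `Code (suc m)`, and then
-- `2n − 3 = 2m + 1`.
codeCount-!! : ∀ m → codeCount (suc m) ≡ suc (m + m) !!
codeCount-!! zero    = refl
codeCount-!! (suc m) rewrite ℕ.+-suc m m = cong (suc (suc (suc (m + m))) *_) (codeCount-!! m)

double∸3 : ∀ m → 2 * suc (suc m) ∸ 3 ≡ suc (m + m)
double∸3 m rewrite ℕ.+-identityʳ m | ℕ.+-suc m (suc m) | ℕ.+-suc m m = refl

hasCardinality : ∀ m → HasCardinality (maximalGallaiSetoid (suc m)) (codeCount m)
hasCardinality m = record
  { to        = codePartition ∘ to
  ; cong      = λ { {i} refl →
      IsEquivalence.refl ≈ᴾ-isEquivalence {proj₁ (codePartition (to i))} }
  ; bijective = (λ eq → injective (codePartition-injective {m} eq)) , λ P →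
      let (c , c≈P) = codePartition-surjective P in
      from c , λ { refl → subst (λ d → proj₁ (codePartition d) ≈ᴾ proj₁ P)
                            (sym (strictlyInverseˡ c)) c≈P }
  }
  where
  open Inverse (enumerate m)
  open Injection (↔⇒↣ (enumerate m)) using (injective)

theorem1p18 : (n : ℕ) → n > 1 →
    HasCardinality (maximalGallaiSetoid n) ((2 * n ∸ 3) !!)
theorem1p18 (suc zero) (s≤s ())
theorem1p18 (suc (suc m)) _ =
  subst (HasCardinality (maximalGallaiSetoid (suc (suc m))))
    (trans (codeCount-!! m) (cong _!! (sym (double∸3 m)))) (hasCardinality (suc m))
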